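{- Let $\mathcal S$ be a sound, finitely axiomatized, sequential theory extending $S^1_2$ with polynomial-time decidable axioms, such that $\mathcal S$ has polynomial-size proofs of $(\mathrm{Con}_{\mathcal S}(n))_n$, and assume SETH-K-Finite for $\mathcal S$ (stated in the context). For every $m>k_R^{\mathcal S}$ and every $\epsilon$ with $0<\epsilon<1$, there exists $N_{R,m,\epsilon}^{\mathcal S}$ such that, for every $n>N_{R,m,\epsilon}^{\mathcal S}$, at least $(1-O(m^{ -d}))2^m$ strings $x\in\{0,1\}^m$ satisfy both $x\in R$ and $\mathcal S\nvdash_{\le 2^{(1-\epsilon)n}}\mathrm{Con}_{\mathcal S+(x\in R)}(n)$.
   Context: $S^1_2$ is Buss's bounded arithmetic theory and $\mathrm{EA}$ is elementary arithmetic. $\mathrm{Con}_{\mathcal T}$ is the consistency statement of $\mathcal T$; $\mathrm{Con}_{\mathcal T}(n)$ asserts that $\mathcal T$ has no proof of contradiction of length at most $n$ symbols. $\mathcal S\vdash_{\le L}\theta$ means that $\theta$ has an $\mathcal S$-proof of length at most $L$, and $\mathcal S\nvdash_{\le L}\theta$ is its negation. A family $\theta(n)$ has polynomial-size $\mathcal S$-proofs if for some constant $c$ and all sufficiently large $n$, $\theta(n)$ has an $\mathcal S$-proof of size at most $n^c$. Fix a deterministic universal Turing machine $U$ and a constant $d\ge 3$; $R=\{x:K_U(x)\ge |x|-d\log|x|\}$, with $K_U$ Kolmogorov complexity without time bound. In $\mathcal S+(x\in R)$ the added axiom is the arithmetized sentence $x\in R$ for the fixed string $x$. Let $C_{\mathrm{rel}}^{\mathcal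 S}=\{x\in R:\mathrm{EA}\vdash \mathrm{Con}_{\mathcal S}\rightarrow\mathrm{Con}_{\mathcal S+(x\in R)}\}$. This set is finite, and $k_R^{\mathcal S}$ is a fixed integer exceeding the maximum length of its elements. SETH-K-Finite for $\mathcal S$: for every $m>k_R^{\mathcal S}$ and every $\epsilon$ with $0<\epsilon<1$, there exists $N_{R,m,\epsilon}^{\mathcal S}$ such that, for every true $x\in R\cap\{0,1\}^m$ and every $n>N_{R,m,\epsilon}^{\mathcal S}$, one has $\mathcal S\vdash_{\le 2^{(1-\epsilon)n}}\mathrm{Con}_{\mathcal S+(x\in R)}(n)$ if and only if $\mathrm{EA}\vdash\mathrm{Con}_{\mathcal S}\rightarrow\mathrm{Con}_{\mathcal S+(x\in R)}$. -}

module Defs where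

open import Data.Bool using (Bool; true; false; if_then_else_)
open import Data.Empty using () renaming (⊥ to Empty)
open import Data.Fin using (Fin; toℕ)
open import Data.Fin.Properties using () renaming (_≟_ to _≟ᶠ_)
open import Data.Integer using (∣_∣)
open import Data.List using (List; []; _∷_; [_]; _++_; length; map; concatMap; reverse; foldl; foldr; filter; allFin; lookup)
open import Data.List.Membership.Propositional using (_∈_; _∉_)
open import Data.List.Relation.Binary.Subset.Propositional using (_⊆_)
open import Data.Nat using (ℕ; zero; suc; _+_; _*_; _^_; _≤_; _<_; ⌊_/2⌋; _≟_)
open import Data.Nat.Binary using (ℕᵇ; zero; 2[1+_]; 1+[2_]; fromℕ)
open import Data.Nat.GeneralisedArithmetic using (iterate)
open import Data.Nat.Logarithm using (⌈log₂_⌉)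
open import Data.Product using (Σ-syntax; ∃; ∃-syntax; _×_; _,_)
open import Data.Rational using (ℚ; ↥_; ↧ₙ_; 0ℚ; 1ℚ) renaming (_<_ to _<ℚ_; _-_ to _-ℚ_)
open import Data.Sum using (_⊎_)
open import Data.Vec using (Vec; []; _∷_)
open import Function using (_⇔_)
open import Relation.Binary.PropositionalEquality using (_≡_)
open import Relation.Nullary using (¬_; does; ¬?)

record ℝ : Set₁ where
  field
    lower upper  : ℚ → Set
    lower-inhab  : ∃[ q ] lower q
    upper-inhab  : ∃[ q ] upper q
    lower-open   : ∀ q → lower q ⇔ (∃[ r ] q <ℚ r × lower r)
    upper-open   : ∀ q → upper q ⇔ (∃[ r ] r <ℚ q × upper r)
    disjoint     : ∀ q → ¬ (lower q × upper q)
    located      : ∀ q r → q <ℚ r → lower q ⊎ upper r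

open ℝ public using (lower; upper)

-- s ≤ 2 ^ ((1 - ε) n), for ε < 1.  By continuity it suffices to bound s by
-- 2 ^ ((1 - q) n) for all rationals q < ε; with 1 - q = a / b > 0 this says
-- s ^ b ≤ 2 ^ (a n).
_≤2^[1-_]*_ : ℕ → ℝ → ℕ → Set
s ≤2^[1- ε ]* n =
  ∀ q → lower ε q → s ^ (↧ₙ (1ℚ -ℚ q)) ≤ 2 ^ (∣ ↥ (1ℚ -ℚ q) ∣ * n)

data Cell (k : ℕ) : Set where
  blank : Cell k
  bit   : Bool → Cell k
  aux   : Fin k → Cell k

data Direction : Set where
  moveL moveR : Direction

record Machine : Set where
  field
    states work : ℕ
  State : Set
  State = Fin states
  Tape : Set
  Tape = Cell work
  field
    start halt : State
    δ          : State → Tape → State × Tape × Direction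

  -- (l , q , r): the head scans the first cell of r; l is the tape to the left
  -- of the head, nearest cell first; everything else is blank.
  Config : Set
  Config = List Tape × State × List Tape

  moved : State × Tape × Direction → List Tape → List Tape → Config
  moved (q , b , moveR) l       r = b ∷ l , q , r
  moved (q , b , moveL) []      r = [] , q , blank ∷ b ∷ r
  moved (q , b , moveL) (e ∷ l) r = l , q , e ∷ b ∷ r

  step : Config → Config
  step (l , q , r) = if does (q ≟ᶠ halt) then (l , q , r) else go r
    where
    go : List Tape → Config
    go []      = moved (δ q blank) l []
    go (a ∷ r) = moved (δ q a) l r

  initial : List Bool → Config
  initial p = [] , start , map bit p

  leadingBits : List Tape → List Bool
  leadingBits (bit b ∷ r) = b ∷ leadingBits r
  leadingBits _           = []

  -- The output is the longest block of bits beginning at the head.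
  OutputWithin : ℕ → List Bool → List Bool → Set
  OutputWithin t p x = ∃[ l ] ∃[ r ]
    iterate step (initial p) t ≡ (l , halt , r) × leadingBits r ≡ x

  _↦_ : List Bool → List Bool → Set
  p ↦ x = ∃[ t ] OutputWithin t p x

Universal : Machine → Set
Universal U = ∀ M → ∃[ e ] ∀ p x →
  (Machine._↦_ M p x ⇔ Machine._↦_ U (e ++ p) x)

PolyTimeDecidable : (List Bool → Set) → Set
PolyTimeDecidable A = ∃[ M ] ∃[ c ] ∀ w →
    (A w   → Machine.OutputWithin M (length w ^ c + c) w [ true ])
  × (¬ A w → Machine.OutputWithin M (length w ^ c + c) w [ false ])

Kolmogorov : Machine → List Bool → ℕ → Set
Kolmogorov U x k =
    (∃[ p ] length p ≡ k × Machine._↦_ U p x)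
  × (∀ p → Machine._↦_ U p x → k ≤ length p)

-- k ≥ |x| - d log₂ |x| is written 2 ^ |x| ≤ 2 ^ k · |x| ^ d.
Random : Machine → ℕ → List Bool → Set
Random U d x = ∃[ k ] Kolmogorov U x k × 2 ^ length x ≤ 2 ^ k * length x ^ d

-- Arities of the symbols added to the arithmetical ones.
record Language : Set where
  field
    funs rels : List ℕ

open Language public

Arith : Language
Arith = record { funs = [] ; rels = [] }

data Fun (L : Language) : ℕ → Set where
  zeroF            : Fun L 0
  sucF lenF halfF  : Fun L 1
  addF mulF smashF : Fun L 2
  extF             : (i : Fin (length (funs L))) → Fun L (lookup (funs L) i)

data Rel (L : Language) : ℕ → Set where
  leR  : Rel L 2
  extR : (i : Fin (length (rels L))) → Rel L (lookup (rels L) i)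

data Term (L : Language) : Set where
  var : ℕ → Term L
  fn  : ∀ {n} → Fun L n → Vec (Term L) n → Term L

infix  8 _≐_ _≼_
infixr 6 _⊃_
infixl 10 _⊗_ _⊠_
infixl 9 _⊕_

data Formula (L : Language) : Set where
  ⊥    : Formula L
  _≐_  : Term L → Term L → Formula L
  rel  : ∀ {n} → Rel L n → Vec (Term L) n → Formula L
  _⊃_  : Formula L → Formula L → Formula L
  all  : ℕ → Formula L → Formula L

pattern 𝟘 = fn zeroF []
pattern S t = fn sucF (t ∷ [])
pattern len t = fn lenF (t ∷ [])
pattern half t = fn halfF (t ∷ [])
pattern _⊕_ s t = fn addF (s ∷ t ∷ [])
pattern _⊗_ s t = fn mulF (s ∷ t ∷ [])
pattern _⊠_ s t = fn smashF (s ∷ t ∷ [])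
pattern _≼_ s t = rel leR (s ∷ t ∷ [])

module _ {L : Language} where

  infix  8 _≺_
  infixr 7 _∧_ _∨_
  infix  6 _⇿_

  𝟙 𝟚 : Term L
  𝟙 = S 𝟘
  𝟚 = S 𝟙

  ~_ : Formula L → Formula L
  ~ A = A ⊃ ⊥

  _∧_ _∨_ _⇿_ : Formula L → Formula L → Formula L
  A ∧ B = ~ (A ⊃ ~ B)
  A ∨ B = ~ A ⊃ B
  A ⇿ B = (A ⊃ B) ∧ (B ⊃ A)

  ex : ℕ → Formula L → Formula L
  ex x A = ~ all x (~ A)

  all≤ : ℕ → Term L → Formula L → Formula L
  all≤ x t A = all x (var x ≼ t ⊃ A)

  _≺_ : Term L → Term L → Formula L
  s ≺ t = S s ≼ t

  varsᵗ  : Term L → List ℕ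
  varsᵗˢ : ∀ {n} → Vec (Term L) n → List ℕ
  varsᵗ (var x)   = [ x ]
  varsᵗ (fn f ts) = varsᵗˢ ts
  varsᵗˢ []       = []
  varsᵗˢ (t ∷ ts) = varsᵗ t ++ varsᵗˢ ts

  -- All variables that occur, quantified ones included.
  vars : Formula L → List ℕ
  vars ⊥          = []
  vars (s ≐ t)    = varsᵗ s ++ varsᵗ t
  vars (rel r ts) = varsᵗˢ ts
  vars (A ⊃ B)    = vars A ++ vars B
  vars (all x A)  = x ∷ vars A

  free : Formula L → List ℕ
  free (A ⊃ B)   = free A ++ free B
  free (all x A) = filter (λ y → ¬? (y ≟ x)) (free A)
  free A         = vars A

  substᵗ  : ℕ → Term L → Term L → Term L
  substᵗˢ : ∀ {n} → ℕ → Term L → Vec (Term L) n → Vec (Term L) n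
  substᵗ x t (var y)   = if does (x ≟ y) then t else var y
  substᵗ x t (fn f ts) = fn f (substᵗˢ x t ts)
  substᵗˢ x t []       = []
  substᵗˢ x t (u ∷ us) = substᵗ x t u ∷ substᵗˢ x t us

  -- Replaces free occurrences of x by t without renaming.  It is only used
  -- where capture cannot occur: either every variable of t is x itself, or no
  -- variable of t occurs in the formula.
  subst : ℕ → Term L → Formula L → Formula L
  subst x t ⊥          = ⊥
  subst x t (s ≐ u)    = substᵗ x t s ≐ substᵗ x t u
  subst x t (rel r ts) = rel r (substᵗˢ x t ts)
  subst x t (A ⊃ B)    = subst x t A ⊃ subst x t B
  subst x t (all y A)  = all y (if does (x ≟ y) then A else subst x t A)

module _ {L : Language} where

  ↑ᵗ  : Term Arith → Term L
  ↑ᵗˢ : ∀ {n} → Vec (Term Arith) n → Vec (Term L) n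
  ↑ᵗ (var x)        = var x
  ↑ᵗ 𝟘              = 𝟘
  ↑ᵗ (S t)          = S (↑ᵗ t)
  ↑ᵗ (len t)        = len (↑ᵗ t)
  ↑ᵗ (half t)       = half (↑ᵗ t)
  ↑ᵗ (s ⊕ t)        = ↑ᵗ s ⊕ ↑ᵗ t
  ↑ᵗ (s ⊗ t)        = ↑ᵗ s ⊗ ↑ᵗ t
  ↑ᵗ (s ⊠ t)        = ↑ᵗ s ⊠ ↑ᵗ t
  ↑ᵗ (fn (extF ()) _)
  ↑ᵗˢ []            = []
  ↑ᵗˢ (t ∷ ts)      = ↑ᵗ t ∷ ↑ᵗˢ ts

  ↑ : Formula Arith → Formula L
  ↑ ⊥                   = ⊥
  ↑ (s ≐ t)             = ↑ᵗ s ≐ ↑ᵗ t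
  ↑ (s ≼ t)             = ↑ᵗ s ≼ ↑ᵗ t
  ↑ (rel (extR ()) _)
  ↑ (A ⊃ B)             = ↑ A ⊃ ↑ B
  ↑ (all x A)           = all x (↑ A)

bitLength : ℕ → ℕ
bitLength n = ⌈log₂ suc n ⌉

⟦_⟧ᵗ : Term Arith → (ℕ → ℕ) → ℕ
⟦ var x ⟧ᵗ  ρ = ρ x
⟦ 𝟘 ⟧ᵗ      ρ = 0
⟦ S t ⟧ᵗ    ρ = suc (⟦ t ⟧ᵗ ρ)
⟦ len t ⟧ᵗ  ρ = bitLength (⟦ t ⟧ᵗ ρ)
⟦ half t ⟧ᵗ ρ = ⌊ ⟦ t ⟧ᵗ ρ /2⌋
⟦ s ⊕ t ⟧ᵗ  ρ = ⟦ s ⟧ᵗ ρ + ⟦ t ⟧ᵗ ρ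
⟦ s ⊗ t ⟧ᵗ  ρ = ⟦ s ⟧ᵗ ρ * ⟦ t ⟧ᵗ ρ
⟦ s ⊠ t ⟧ᵗ  ρ = 2 ^ (bitLength (⟦ s ⟧ᵗ ρ) * bitLength (⟦ t ⟧ᵗ ρ))
⟦ fn (extF ()) _ ⟧ᵗ

_[_↦_] : (ℕ → ℕ) → ℕ → ℕ → ℕ → ℕ
(ρ [ x ↦ a ]) y = if does (x ≟ y) then a else ρ y

True : Formula Arith → (ℕ → ℕ) → Set
True ⊥         ρ = Empty
True (s ≐ t)   ρ = ⟦ s ⟧ᵗ ρ ≡ ⟦ t ⟧ᵗ ρ
True (s ≼ t)   ρ = ⟦ s ⟧ᵗ ρ ≤ ⟦ t ⟧ᵗ ρ
True (rel (extR ()) _)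
True (A ⊃ B)   ρ = True A ρ → True B ρ
True (all x A) ρ = ∀ a → True A (ρ [ x ↦ a ])

data Symbol : Set where
  varS funS relS zeroS oneS stopS eqS botS impS allS sepS : Symbol

String : Set
String = List Symbol

digits : ℕᵇ → String
digits zero     = [ stopS ]
digits 2[1+ b ] = zeroS ∷ digits b
digits 1+[2 b ] = oneS ∷ digits b

number : ℕ → String
number n = digits (fromℕ n)

module _ {L : Language} where

  funString : ∀ {n} → Fun L n → String
  funString f = funS ∷ number (index f)
    where
    index : ∀ {n} → Fun L n → ℕ
    index zeroF    = 0
    index sucF     = 1
    index lenF     = 2
    index halfF    = 3
    index addF     = 4
    index mulF     = 5
    index smashF   = 6
    index (extF i) = 7 + toℕ i

  relString : ∀ {n} → Rel L n → String
  relString r = relS ∷ number (index r)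
    where
    index : ∀ {n} → Rel L n → ℕ
    index leR      = 0
    index (extR i) = 1 + toℕ i

  stringᵗ  : Term L → String
  stringᵗˢ : ∀ {n} → Vec (Term L) n → String
  stringᵗ (var x)   = varS ∷ number x
  stringᵗ (fn f ts) = funString f ++ stringᵗˢ ts
  stringᵗˢ []       = []
  stringᵗˢ (t ∷ ts) = stringᵗ t ++ stringᵗˢ ts

  string : Formula L → String
  string ⊥          = [ botS ]
  string (s ≐ t)    = eqS ∷ stringᵗ s ++ stringᵗ t
  string (rel r ts) = relString r ++ stringᵗˢ ts
  string (A ⊃ B)    = impS ∷ string A ++ string B
  string (all x A)  = allS ∷ stringᵗ (var {L} x) ++ string A

-- Every symbol is a five-bit word with leading bit 1; as numbers these words
-- are 16, …, 26.
bits : Symbol → List Bool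
bits varS  = true ∷ false ∷ false ∷ false ∷ false ∷ []
bits funS  = true ∷ false ∷ false ∷ false ∷ true  ∷ []
bits relS  = true ∷ false ∷ false ∷ true  ∷ false ∷ []
bits zeroS = true ∷ false ∷ false ∷ true  ∷ true  ∷ []
bits oneS  = true ∷ false ∷ true  ∷ false ∷ false ∷ []
bits stopS = true ∷ false ∷ true  ∷ false ∷ true  ∷ []
bits eqS   = true ∷ false ∷ true  ∷ true  ∷ false ∷ []
bits botS  = true ∷ false ∷ true  ∷ true  ∷ true  ∷ []
bits impS  = true ∷ true  ∷ false ∷ false ∷ false ∷ []
bits allS  = true ∷ true  ∷ false ∷ false ∷ true  ∷ []
bits sepS  = true ∷ true  ∷ false ∷ true  ∷ false ∷ []

binary : String → List Bool
binary = concatMap bits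

-- The code of a string of l symbols has exactly 5 l binary digits, and the
-- empty string has code 0.
code : String → ℕ
code s = foldl (λ n b → if b then 2 * n + 1 else 2 * n) 0 (binary s)

Theory : Language → Set₁
Theory L = Formula L → Set

-- Open axioms stand for their universal closures.
FiniteTheory : Language → Set
FiniteTheory L = List (Formula L)

⟨_⟩ : ∀ {L} → FiniteTheory L → Theory L
⟨ T ⟩ A = A ∈ T

module _ {L : Language} where

  equalities : ∀ {n} → Vec (Term L) n → Vec (Term L) n → Formula L → Formula L
  equalities []       []       A = A
  equalities (s ∷ ss) (t ∷ ts) A = s ≐ t ⊃ equalities ss ts A

  -- The substitution-free axiomatization of predicate logic with equality due
  -- to Tarski, Kalish and Montague; instances A[t/x] of ∀x A are derived from
  -- ∃x (x = t) and the congruence axioms.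
  data Logical : Formula L → Set where
    weaken : ∀ A B → Logical (A ⊃ B ⊃ A)
    distr  : ∀ A B C → Logical ((A ⊃ B ⊃ C) ⊃ (A ⊃ B) ⊃ A ⊃ C)
    stable : ∀ A → Logical ((~ ~ A) ⊃ A)
    ∀-mono : ∀ x A B → Logical (all x (A ⊃ B) ⊃ all x A ⊃ all x B)
    ∀-elim : ∀ x A → Logical (all x A ⊃ A)
    vacuous : ∀ x A → x ∉ vars A → Logical (A ⊃ all x A)
    exists : ∀ x t → x ∉ varsᵗ t → Logical (~ all x (~ (var x ≐ t)))
    eq-refl : ∀ t → Logical (t ≐ t)
    eq-eucl : ∀ s t u → Logical (s ≐ t ⊃ s ≐ u ⊃ t ≐ u)
    fun-cong : ∀ {n} (f : Fun L n) ss ts →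
      Logical (equalities ss ts (fn f ss ≐ fn f ts))
    rel-cong : ∀ {n} (r : Rel L n) ss ts →
      Logical (equalities ss ts (rel r ss ⊃ rel r ts))

  data Justified (T : Theory L) (Γ : List (Formula L)) : Formula L → Set where
    logical : ∀ {A} → Logical A → Justified T Γ A
    axiom   : ∀ {A} → T A → Justified T Γ A
    mp      : ∀ {A B} → A ∈ Γ → (A ⊃ B) ∈ Γ → Justified T Γ B
    gen     : ∀ {A} x → A ∈ Γ → Justified T Γ (all x A)

  infixr 5 _∷_

  -- The lines of a proof, last line first.
  data Proof (T : Theory L) : List (Formula L) → Set where
    []  : Proof T []
    _∷_ : ∀ {A Γ} → Justified T Γ A → Proof T Γ → Proof T (A ∷ Γ)

  proofString : List (Formula L) → String
  proofString Γ = sepS ∷ concatMap (λ A → string A ++ [ sepS ]) (reverse Γ)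

  infix 3 _⊢_ _⊢[_]_

  _⊢_ : Theory L → Formula L → Set
  T ⊢ A = ∃[ Γ ] Proof T (A ∷ Γ)

  -- Provability by a proof whose length in symbols satisfies a given bound.
  _⊢[_]_ : Theory L → (ℕ → Set) → Formula L → Set
  T ⊢[ Bound ] A = ∃[ Γ ] Proof T (A ∷ Γ) × Bound (length (proofString (A ∷ Γ)))

-- Buss's 32 axioms BASIC; conjuncts are not split.
basic : List (Formula Arith)
basic =
  y ≼ x ⊃ y ≼ S x ∷
  ~ (x ≐ S x) ∷
  𝟘 ≼ x ∷
  ((x ≼ y ∧ ~ (x ≐ y)) ⇿ S x ≼ y) ∷
  ~ (x ≐ 𝟘) ⊃ ~ (𝟚 ⊗ x ≐ 𝟘) ∷
  y ≼ x ∨ x ≼ y ∷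
  x ≼ y ∧ y ≼ x ⊃ x ≐ y ∷
  x ≼ y ∧ y ≼ z ⊃ x ≼ z ∷
  len 𝟘 ≐ 𝟘 ∷
  ~ (x ≐ 𝟘) ⊃ len (𝟚 ⊗ x) ≐ S (len x) ∧ len (S (𝟚 ⊗ x)) ≐ S (len x) ∷
  len 𝟙 ≐ 𝟙 ∷
  x ≼ y ⊃ len x ≼ len y ∷
  len (x ⊠ y) ≐ S (len x ⊗ len y) ∷
  𝟘 ⊠ y ≐ 𝟙 ∷
  ~ (x ≐ 𝟘) ⊃ 𝟙 ⊠ (𝟚 ⊗ x) ≐ 𝟚 ⊗ (𝟙 ⊠ x) ∧ 𝟙 ⊠ S (𝟚 ⊗ x) ≐ 𝟚 ⊗ (𝟙 ⊠ x) ∷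
  x ⊠ y ≐ y ⊠ x ∷
  len x ≐ len y ⊃ x ⊠ z ≐ y ⊠ z ∷
  len x ≐ len u ⊕ len v ⊃ x ⊠ y ≐ (u ⊠ y) ⊗ (v ⊠ y) ∷
  x ≼ x ⊕ y ∷
  x ≼ y ∧ ~ (x ≐ y) ⊃ S (𝟚 ⊗ x) ≼ 𝟚 ⊗ y ∧ ~ (S (𝟚 ⊗ x) ≐ 𝟚 ⊗ y) ∷
  x ⊕ y ≐ y ⊕ x ∷
  x ⊕ 𝟘 ≐ x ∷
  x ⊕ S y ≐ S (x ⊕ y) ∷
  (x ⊕ y) ⊕ z ≐ x ⊕ (y ⊕ z) ∷
  (x ⊕ y ≼ x ⊕ z ⇿ y ≼ z) ∷
  x ⊗ 𝟘 ≐ 𝟘 ∷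
  x ⊗ S y ≐ (x ⊗ y) ⊕ x ∷
  x ⊗ y ≐ y ⊗ x ∷
  x ⊗ (y ⊕ z) ≐ (x ⊗ y) ⊕ (x ⊗ z) ∷
  𝟙 ≼ x ⊃ (x ⊗ y ≼ x ⊗ z ⇿ y ≼ z) ∷
  ~ (x ≐ 𝟘) ⊃ len x ≐ S (len (half x)) ∷
  (x ≐ half y ⇿ (𝟚 ⊗ x ≐ y ∨ S (𝟚 ⊗ x) ≐ y)) ∷
  []
  where
  x y z u v : Term Arith
  x = var 0
  y = var 1
  z = var 2
  u = var 3
  v = var 4

data Polarity : Set where
  σ π : Polarity

dual : Polarity → Polarity
dual σ = π
dual π = σ

-- Σᵇ₁ and Πᵇ₁, with all connectives reduced to ⊥, ⊃ and ∀.  The existential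
-- bounded quantifier of Σᵇ₁ is obtained as ¬ ∀x≤t ¬.
data Bounded₁ : Polarity → Formula Arith → Set where
  bot   : ∀ {p} → Bounded₁ p ⊥
  eq    : ∀ {p s t} → Bounded₁ p (s ≐ t)
  atom  : ∀ {p n} {r : Rel Arith n} {ts} → Bounded₁ p (rel r ts)
  imp   : ∀ {p A B} → Bounded₁ (dual p) A → Bounded₁ p B → Bounded₁ p (A ⊃ B)
  sharp : ∀ {p x t A} → x ∉ varsᵗ t → Bounded₁ p A → Bounded₁ p (all≤ x (len t) A)
  all-π : ∀ {x t A} → x ∉ varsᵗ t → Bounded₁ π A → Bounded₁ π (all≤ x t A)

data Bounded : Formula Arith → Set where
  bot  : Bounded ⊥
  eq   : ∀ {s t} → Bounded (s ≐ t)
  atom : ∀ {n} {r : Rel Arith n} {ts} → Bounded (rel r ts)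
  imp  : ∀ {A B} → Bounded A → Bounded B → Bounded (A ⊃ B)
  all  : ∀ {x t A} → x ∉ varsᵗ t → Bounded A → Bounded (all≤ x t A)

data S¹₂ : Theory Arith where
  base : ∀ {A} → A ∈ basic → S¹₂ A
  pind : ∀ x {A} → Bounded₁ σ A →
    S¹₂ (subst x 𝟘 A ⊃ all x (subst x (half (var x)) A ⊃ A) ⊃ all x A)

-- Elementary arithmetic IΔ₀ + exp, presented as a definitional extension in
-- Buss's language.  Since |y| = x for some y exactly when 2 ^ x exists up to a
-- factor of two, totality of exponentiation reads ∀x ∃y |y| = x.
data EA : Theory Arith where
  base : ∀ {A} → A ∈ basic → EA A
  ind  : ∀ x {A} → Bounded A →
    EA (subst x 𝟘 A ⊃ all x (A ⊃ subst x (S (var x)) A) ⊃ all x A)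
  exp  : EA (all 0 (ex 1 (len (var 1) ≐ var 0)))

-- A formula under construction, given the least variable not yet in use.
-- Quantifiers take that variable, so no two nested quantifiers clash.
Form : Set
Form = ℕ → Formula Arith

ATerm : Set
ATerm = Term Arith

infix  7 _=ᶠ_ _≤ᶠ_ _<ᶠ_
infixr 6 _&_
infixr 5 _∥_
infixr 4 _⇒_
infixr 8 _⌢_

_=ᶠ_ _≤ᶠ_ _<ᶠ_ : ATerm → ATerm → Form
(s =ᶠ t) _ = s ≐ t
(s ≤ᶠ t) _ = s ≼ t
(s <ᶠ t) _ = s ≺ t

falsum : Form
falsum _ = ⊥

_⇒_ _&_ _∥_ : Form → Form → Form
(A ⇒ B) k = A k ⊃ B k
(A & B) k = A k ∧ B k
(A ∥ B) k = A k ∨ B k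

not : Form → Form
not A = A ⇒ falsum

⋁ : ∀ {a} {X : Set a} → List X → (X → Form) → Form
⋁ xs A = foldr (λ x B → A x ∥ B) falsum xs

forAll : (ATerm → Form) → Form
forAll A k = all k (A (var k) (suc k))

forAll≤ exists≤ : ATerm → (ATerm → Form) → Form
forAll≤ t A = forAll λ x → x ≤ᶠ t ⇒ A x
exists≤ t A = not (forAll≤ t λ x → not (A x))

sentence : Form → Formula Arith
sentence A = A 0

numeral : ℕ → ATerm
numeral n = go (fromℕ n)
  where
  go : ℕᵇ → ATerm
  go zero     = 𝟘
  go 2[1+ b ] = 𝟚 ⊗ S (go b)
  go 1+[2 b ] = S (𝟚 ⊗ go b)

⌜_⌝ : String → ATerm
⌜ s ⌝ = numeral (code s)

-- Concatenation of codes: 1 # t = 2 ^ |t|.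
_⌢_ : ATerm → ATerm → ATerm
s ⌢ t = s ⊗ (𝟙 ⊠ t) ⊕ t

multipleOf5 : ATerm → Form
multipleOf5 n = exists≤ n λ k → n =ᶠ numeral 5 ⊗ k

-- x is the code of a string: |x| is a multiple of 5 and every block
-- of five binary digits is one of the numbers 16, …, 26.
isString : ATerm → Form
isString x = multipleOf5 (len x) & forAll≤ x λ z →
  multipleOf5 (len z) & len z <ᶠ len x ⇒
  forAll≤ x λ a → forAll≤ (numeral 31) λ s → forAll≤ x λ c →
  c <ᶠ 𝟙 ⊠ z & x =ᶠ (a ⊗ numeral 32 ⊕ s) ⊗ (𝟙 ⊠ z) ⊕ c ⇒
  numeral 16 ≤ᶠ s & s ≤ᶠ numeral 26

forStr≤ existsStr≤ : ATerm → (ATerm → Form) → Form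
forStr≤ t A = forAll≤ t λ x → isString x ⇒ A x
existsStr≤ t A = exists≤ t λ x → isString x & A x

occursIn : ATerm → ATerm → Form
occursIn y x = existsStr≤ x λ a → existsStr≤ x λ b → x =ᶠ a ⌢ y ⌢ b

sep : ATerm
sep = ⌜ [ sepS ] ⌝

isLine : ATerm → Form
isLine e = not (occursIn sep e)

lineOf : ATerm → ATerm → Form
lineOf w e = isLine e &
  existsStr≤ w λ a → existsStr≤ w λ b → w =ᶠ a ⌢ sep ⌢ e ⌢ sep ⌢ b

lastLineOf : ATerm → ATerm → Form
lastLineOf w e = isLine e & existsStr≤ w λ a → w =ᶠ a ⌢ sep ⌢ e ⌢ sep

-- w has the shape ;e₁;e₂;…;eₙ; and A u eᵢ holds for all i, where u is the
-- part ;e₁;…;eᵢ₋₁; of w.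
sequence : ATerm → (ATerm → ATerm → Form) → Form
sequence w A =
  (existsStr≤ w λ b → w =ᶠ sep ⌢ b) &
  (existsStr≤ w λ a → w =ᶠ a ⌢ sep) &
  (forStr≤ w λ a → forStr≤ w λ e → forStr≤ w λ b →
    w =ᶠ a ⌢ sep ⌢ e ⌢ sep ⌢ b & isLine e ⇒ A (a ⌢ sep) e)

existsLine : ATerm → (ATerm → Form) → Form
existsLine w A = existsStr≤ w λ e → lineOf w e & A e

existsLines : ∀ n → ATerm → (Vec ATerm n → Form) → Form
existsLines zero    w A = A []
existsLines (suc n) w A = existsLine w λ e → existsLines n w λ es → A (e ∷ es)

isBits : ATerm → Form
isBits d = forStr≤ d λ a → forStr≤ d λ s → forStr≤ d λ b →
  d =ᶠ a ⌢ s ⌢ b & len s =ᶠ numeral 5 ⇒ s =ᶠ ⌜ [ zeroS ] ⌝ ∥ s =ᶠ ⌜ [ oneS ] ⌝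

isVar : ATerm → Form
isVar x = existsStr≤ x λ d → isBits d & x =ᶠ ⌜ [ varS ] ⌝ ⌢ d ⌢ ⌜ [ stopS ] ⌝

existsVar≤ : ATerm → (ATerm → Form) → Form
existsVar≤ t A = existsStr≤ t λ x → isVar x & A x

⊥ᶜ : ATerm
⊥ᶜ = ⌜ [ botS ] ⌝

infix  7 _≐ᶜ_
infixr 5 _⊃ᶜ_

_≐ᶜ_ _⊃ᶜ_ allᶜ : ATerm → ATerm → ATerm
s ≐ᶜ t = ⌜ [ eqS ] ⌝ ⌢ s ⌢ t
A ⊃ᶜ B = ⌜ [ impS ] ⌝ ⌢ A ⌢ B
allᶜ x A = ⌜ [ allS ] ⌝ ⌢ x ⌢ A

~ᶜ_ : ATerm → ATerm
~ᶜ A = A ⊃ᶜ ⊥ᶜ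

applyᶜ : ∀ {n} → String → Vec ATerm n → ATerm
applyᶜ s ts = ⌜ s ⌝ ⌢ go ts
  where
  go : ∀ {n} → Vec ATerm n → ATerm
  go []       = 𝟘
  go (t ∷ ts) = t ⌢ go ts

equalitiesᶜ : ∀ {n} → Vec ATerm n → Vec ATerm n → ATerm → ATerm
equalitiesᶜ []       []       A = A
equalitiesᶜ (s ∷ ss) (t ∷ ts) A = s ≐ᶜ t ⊃ᶜ equalitiesᶜ ss ts A

allFuns : ∀ L → List (∃ (Fun L))
allFuns L =
  (_ , zeroF) ∷ (_ , sucF) ∷ (_ , lenF) ∷ (_ , halfF) ∷
  (_ , addF) ∷ (_ , mulF) ∷ (_ , smashF) ∷ map (λ i → _ , extF i) (allFin _)

allRels : ∀ L → List (∃ (Rel L))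
allRels L = (_ , leR) ∷ map (λ i → _ , extR i) (allFin _)

module _ {L : Language} where

  -- w is a formation sequence of terms.
  terms : ATerm → Form
  terms w = sequence w λ u e →
      isVar e
    ∥ ⋁ (allFuns L) λ (n , f) → existsLines n u λ ts → e =ᶠ applyᶜ (funString f) ts

  -- w is a formation sequence of formulas whose terms are among the lines of w₁.
  formulas : ATerm → ATerm → Form
  formulas w₁ w = sequence w λ u e →
      e =ᶠ ⊥ᶜ
    ∥ (existsLine w₁ λ s → existsLine w₁ λ t → e =ᶠ (s ≐ᶜ t))
    ∥ (⋁ (allRels L) λ (n , r) → existsLines n w₁ λ ts → e =ᶠ applyᶜ (relString r) ts)
    ∥ (existsLine u λ A → existsLine u λ B → e =ᶠ (A ⊃ᶜ B))
    ∥ (existsVar≤ e λ x → existsLine u λ A → e =ᶠ allᶜ x A)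

  logicalᶜ : ATerm → ATerm → ATerm → Form
  logicalᶜ w₁ w₂ e =
      (someA λ A → someA λ B → e =ᶠ (A ⊃ᶜ B ⊃ᶜ A))
    ∥ (someA λ A → someA λ B → someA λ C →
        e =ᶠ ((A ⊃ᶜ B ⊃ᶜ C) ⊃ᶜ (A ⊃ᶜ B) ⊃ᶜ A ⊃ᶜ C))
    ∥ (someA λ A → e =ᶠ ((~ᶜ ~ᶜ A) ⊃ᶜ A))
    ∥ (somex λ x → someA λ A → someA λ B →
        e =ᶠ (allᶜ x (A ⊃ᶜ B) ⊃ᶜ allᶜ x A ⊃ᶜ allᶜ x B))
    ∥ (somex λ x → someA λ A → e =ᶠ (allᶜ x A ⊃ᶜ A))
    ∥ (somex λ x → someA λ A → not (occursIn x A) & e =ᶠ (A ⊃ᶜ allᶜ x A))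
    ∥ (somex λ x → somet λ t → not (occursIn x t) & e =ᶠ (~ᶜ allᶜ x (~ᶜ (x ≐ᶜ t))))
    ∥ (somet λ t → e =ᶠ (t ≐ᶜ t))
    ∥ (somet λ s → somet λ t → somet λ u → e =ᶠ (s ≐ᶜ t ⊃ᶜ s ≐ᶜ u ⊃ᶜ t ≐ᶜ u))
    ∥ (⋁ (allFuns L) λ (n , f) → existsLines n w₁ λ ss → existsLines n w₁ λ ts →
        e =ᶠ equalitiesᶜ ss ts (applyᶜ (funString f) ss ≐ᶜ applyᶜ (funString f) ts))
    ∥ (⋁ (allRels L) λ (n , r) → existsLines n w₁ λ ss → existsLines n w₁ λ ts →
        e =ᶠ equalitiesᶜ ss ts (applyᶜ (relString r) ss ⊃ᶜ applyᶜ (relString r) ts))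
    where
    someA somet somex : (ATerm → Form) → Form
    someA = existsLine w₂
    somet = existsLine w₁
    somex = existsVar≤ e

  -- p is the string of a proof from the given axioms, with last line ⊥.
  -- The formation sequences for the terms and formulas in a proof of N symbols
  -- need at most N (N + 1) + 1 symbols each, so p # p bounds their codes.
  refutation : FiniteTheory L → ATerm → Form
  refutation Ax p =
    existsStr≤ (p ⊠ p) λ w₁ → terms w₁ &
    (existsStr≤ (p ⊠ p) λ w₂ → formulas w₁ w₂ &
    (sequence p λ u e → lineOf w₂ e &
      (logicalᶜ w₁ w₂ e
      ∥ (⋁ Ax λ A → e =ᶠ ⌜ string A ⌝)
      ∥ (existsLine u λ A → lineOf u (A ⊃ᶜ e))
      ∥ (existsVar≤ e λ x → existsLine u λ A → e =ᶠ allᶜ x A)))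
    & lastLineOf p ⊥ᶜ)

  Con : FiniteTheory L → Formula Arith
  Con Ax = sentence (forAll λ p → isString p ⇒ not (refutation Ax p))

  -- A string of at most n symbols has a code of at most 5 n binary digits.
  Con≤ : FiniteTheory L → ℕ → Formula Arith
  Con≤ Ax n = sentence (forAll λ p →
    len p ≤ᶠ numeral 5 ⊗ numeral n ⇒ isString p ⇒ not (refutation Ax p))

bitString : List Bool → String
bitString = map λ b → if b then oneS else zeroS

module _ (M : Machine) where
  open Machine M

  -- A configuration is the string of its tape with the state written directly
  -- before the scanned cell; bits are their own names.
  stateᶜ : State → ATerm
  stateᶜ q = ⌜ funS ∷ number (toℕ q) ⌝

  cellᶜ : Tape → ATerm
  cellᶜ blank   = ⌜ [ eqS ] ⌝
  cellᶜ (bit b) = ⌜ bitString [ b ] ⌝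
  cellᶜ (aux i) = ⌜ varS ∷ number (toℕ i) ⌝

  allCells : List Tape
  allCells = blank ∷ bit false ∷ bit true ∷ map aux (allFin _)

  -- c has state q scanning a, with u to the left and v to the right.
  reads : ATerm → ATerm → State → Tape → ATerm → Form
  reads c u q a v = c =ᶠ u ⌢ stateᶜ q ⌢ cellᶜ a ⌢ v ∥ beyond a
    where
    beyond : Tape → Form
    beyond blank = c =ᶠ u ⌢ stateᶜ q & v =ᶠ 𝟘
    beyond _     = falsum

  stepᶜ : ATerm → ATerm → Form
  stepᶜ c c′ = ⋁ (filter (λ q → ¬? (q ≟ᶠ halt)) (allFin _)) λ q →
    ⋁ allCells λ a → becomes q a (δ q a)
    where
    becomes : State → Tape → State × Tape × Direction → Form
    becomes q a (q′ , b , moveR) =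
      existsStr≤ c λ u → existsStr≤ c λ v →
        reads c u q a v & c′ =ᶠ u ⌢ cellᶜ b ⌢ stateᶜ q′ ⌢ v
    becomes q a (q′ , b , moveL) =
        (existsStr≤ c λ v →
          reads c 𝟘 q a v & c′ =ᶠ stateᶜ q′ ⌢ cellᶜ blank ⌢ cellᶜ b ⌢ v)
      ∥ (⋁ allCells λ e → existsStr≤ c λ u → existsStr≤ c λ v →
          reads c (u ⌢ cellᶜ e) q a v &
          c′ =ᶠ u ⌢ stateᶜ q′ ⌢ cellᶜ e ⌢ cellᶜ b ⌢ v)

  -- h is a halting computation on input p with output x.
  computation : ATerm → ATerm → ATerm → Form
  computation h p x =
    (sequence h λ u e →
        u =ᶠ sep & e =ᶠ stateᶜ start ⌢ p
      ∥ (existsStr≤ u λ c → lastLineOf u c & stepᶜ c e)) &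
    (existsStr≤ h λ c → lastLineOf h c &
      (existsStr≤ c λ u → existsStr≤ c λ v →
        c =ᶠ u ⌢ stateᶜ halt ⌢ x ⌢ v &
        not (⋁ (false ∷ true ∷ []) λ b →
          existsStr≤ v λ v′ → v =ᶠ cellᶜ (bit b) ⌢ v′)))

  -- The sentence "x ∈ R": every program p for x satisfies
  -- 2 ^ |x| ≤ 2 ^ |p| · |x| ^ d.  As a bit of p takes five binary digits in the
  -- code of p, |p| is the binary length of any z with 5 |z| equal to that of
  -- the code, and 1 # z = 2 ^ |p|.
  random : ℕ → List Bool → Formula Arith
  random d x = sentence (forAll λ p → isString p & isBits p ⇒
    forAll λ h → isString h & computation h p ⌜ bitString x ⌝ ⇒
    forAll λ z → len p =ᶠ numeral 5 ⊗ len z ⇒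
    numeral (2 ^ length x) ≤ᶠ (𝟙 ⊠ z) ⊗ numeral (length x ^ d))

module _ {L : Language} (Ax : FiniteTheory L) where

  Sound : Set
  Sound = ∀ A → ⟨ Ax ⟩ ⊢ ↑ A → ∀ ρ → True A ρ

  ExtendsS¹₂ : Set
  ExtendsS¹₂ = ∀ A → S¹₂ A → ⟨ Ax ⟩ ⊢ ↑ A

  -- Direct interpretation of adjunctive set theory: some formula E, read as
  -- v₀ ∈ v₁, has an empty set and adjunction.
  Sequential : Set
  Sequential = Σ[ E ∈ Formula L ]
      free E ⊆ 0 ∷ 1 ∷ [] × 2 ∉ vars E × 3 ∉ vars E
    × (⟨ Ax ⟩ ⊢ ex 1 (all 0 (~ E)))
    × (⟨ Ax ⟩ ⊢ all 1 (all 3 (ex 2 (all 0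
        (subst 1 (var 2) E ⇿ (E ∨ var 0 ≐ var 3))))))

  PolyTimeAxioms : Set
  PolyTimeAxioms = PolyTimeDecidable λ w → ∃[ A ] A ∈ Ax × w ≡ binary (string A)

  PolySizeProofs : (ℕ → Formula Arith) → Set
  PolySizeProofs θ = ∃[ c ] ∃[ n₀ ] ∀ n → n₀ ≤ n → ⟨ Ax ⟩ ⊢[ _≤ n ^ c ] ↑ (θ n)

  module _ (U : Machine) (d : ℕ) where

    -- The theory 𝒮 + (x ∈ R).
    plusRandom : List Bool → FiniteTheory L
    plusRandom x = ↑ (random U d x) ∷ Ax

    RelativelyConsistent : List Bool → Set
    RelativelyConsistent x = EA ⊢ Con Ax ⊃ Con (plusRandom x)

    ShortProof : ℝ → ℕ → List Bool → Set
    ShortProof ε n x =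
      ⟨ Ax ⟩ ⊢[ (λ s → s ≤2^[1- ε ]* n) ] ↑ (Con≤ (plusRandom x) n)

    C-rel : List Bool → Set
    C-rel x = Random U d x × RelativelyConsistent x

    SETH-K-Finite : ℕ → Set₁
    SETH-K-Finite kR = ∀ m → kR < m → ∀ ε → lower ε 0ℚ → upper ε 1ℚ →
      ∃[ N ] ∀ x → length x ≡ m → Random U d x → ∀ n → N < n →
        ShortProof ε n x ⇔ RelativelyConsistent x

{-# OPTIONS --safe #-}
module Submission where

open import Axiom.ExcludedMiddle using (ExcludedMiddle)
open import Data.Bool using (Bool; true; false)
open import Data.Fin using (Fin; zero; suc; fromℕ<)
open import Data.Fin.Properties using (pigeonhole; fromℕ<-injective; <⇒≢; any?)
  renaming (_≟_ to _≟ᶠ_)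
open import Data.List using (List; []; _∷_; _++_; length; lookup; map; filter; cartesianProductWith)
open import Data.List.Membership.Propositional using (_∈_)
open import Data.List.Membership.Propositional.Properties using (∈-lookup; ∈-filter⁻)
open import Data.List.Properties using (∷-injective; length-map; length-++)
open import Data.List.Relation.Ternary.Interleaving.Properties using (interleave-length)
import Data.List.Relation.Ternary.Interleaving.Setoid.Properties as Interleaving
open import Data.List.Relation.Unary.All as All using (All; []; _∷_)
open import Data.List.Relation.Unary.All.Properties using (cartesianProductWith⁺)
open import Data.List.Relation.Unary.AllPairs using ([]; _∷_)
open import Data.List.Relation.Unary.Unique.Propositional using (Unique)
import Data.List.Relation.Unary.Unique.Propositional.Properties as Unique
open import Data.Nat using (ℕ; zero; suc; _+_; _*_; _^_; _≤_; _<_; z≤n; s≤s; _≤?_)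
open import Data.Nat.Binary using (ℕᵇ; 2[1+_]; 1+[2_]; toℕ)
  renaming (zero to 0ᵇ)
open import Data.Nat.Binary.Properties using (toℕ-injective; 2[1+_]-injective; 1+[2_]-injective)
open import Data.Nat.GeneralisedArithmetic using (iterate)
open import Data.Nat.Induction using (<-wellFounded)
open import Data.Nat.Properties hiding (<⇒≢)
open import Data.Product using (∃-syntax; _×_; _,_; proj₁; proj₂)
open import Data.Rational using (0ℚ; 1ℚ)
open import Function using (_∘_; Injective; Equivalence)
open import Induction.WellFounded using (Acc; acc)
open import Level using (0ℓ)
open import Relation.Binary.PropositionalEquality
  using (_≡_; refl; sym; trans; cong; cong₂; subst; setoid)
open import Relation.Nullary using (¬_; yes; no; contradiction; ¬?)
open import Relation.Unary using (Decidable)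
open import Defs hiding (subst; eq; S)

-- Fewer than 2 · 2ᵐ / mᵈ programs are shorter than m − d log m, and each has at
-- most one output, so all but that many strings of length m are random.  For a
-- random x of length m > kR a short proof would put x into the set C-rel by
-- SETH-K-Finite, but the elements of C-rel are shorter than kR.

lookup-injective : ∀ {A : Set} {xs : List A} → Unique xs → Injective _≡_ _≡_ (lookup xs)
lookup-injective (_ ∷ _)   {zero}  {zero}  _  = refl
lookup-injective (x∉ ∷ _)  {zero}  {suc j} eq = contradiction eq (All.lookup x∉ (∈-lookup j))
lookup-injective (x∉ ∷ _)  {suc i} {zero}  eq = contradiction (sym eq) (All.lookup x∉ (∈-lookup i))
lookup-injective (_ ∷ xs!) {suc i} {suc j} eq = cong suc (lookup-injective xs! eq)

-- Otherwise all values would lie below `n`, and the pigeonhole principle would make two of the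
-- `suc n` arguments collide.
injective-attains-≥ : ∀ {n} (f : Fin (suc n) → ℕ) → Injective _≡_ _≡_ f → ∃[ i ] n ≤ f i
injective-attains-≥ {n} f f-inj with any? (λ i → n ≤? f i)
... | yes large = large
... | no  small =
  let f< = λ i → ≰⇒> (λ n≤ → small (i , n≤))
      i , j , i<j , eq = pigeonhole (n<1+n n) (λ i → fromℕ< (f< i))
  in contradiction (f-inj (fromℕ<-injective _ _ _ _ eq)) (<⇒≢ i<j)

length-filter-complement : ∀ {A : Set} {P : A → Set} (P? : Decidable P) xs →
  length xs ≡ length (filter P? xs) + length (filter (¬? ∘ P?) xs)
length-filter-complement P? xs =
  interleave-length (Interleaving.filter⁺ (setoid _) P? xs)

length-cartesianProductWith : ∀ {A B C : Set} (f : A → B → C) xs ys →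
  length (cartesianProductWith f xs ys) ≡ length xs * length ys
length-cartesianProductWith f []       ys = refl
length-cartesianProductWith f (x ∷ xs) ys = trans (length-++ (map (f x) ys))
  (cong₂ _+_ (length-map (f x) ys) (length-cartesianProductWith f xs ys))

-- Bijective base-2 numeration with digits 1 and 2, least significant first. Unlike ordinary binary
-- it has no redundant leading zeros, so programs of all lengths receive different numbers; those of
-- length k get 2ᵏ - 1, ..., 2ᵏ⁺¹ - 2.
toBijectiveBinary : List Bool → ℕᵇ
toBijectiveBinary []          = 0ᵇ
toBijectiveBinary (false ∷ p) = 1+[2 toBijectiveBinary p ]
toBijectiveBinary (true ∷ p)  = 2[1+ toBijectiveBinary p ]

toBijectiveBinary-injective : Injective _≡_ _≡_ toBijectiveBinary
toBijectiveBinary-injective {[]}        {[]}        _  = refl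
toBijectiveBinary-injective {[]}        {false ∷ _} ()
toBijectiveBinary-injective {[]}        {true ∷ _}  ()
toBijectiveBinary-injective {false ∷ _} {[]}        ()
toBijectiveBinary-injective {true ∷ _}  {[]}        ()
toBijectiveBinary-injective {false ∷ _} {true ∷ _}  ()
toBijectiveBinary-injective {true ∷ _}  {false ∷ _} ()
toBijectiveBinary-injective {false ∷ _} {false ∷ _} eq =
  cong (false ∷_) (toBijectiveBinary-injective (1+[2_]-injective eq))
toBijectiveBinary-injective {true ∷ _}  {true ∷ _}  eq =
  cong (true ∷_) (toBijectiveBinary-injective (2[1+_]-injective eq))

-- The bound is attained when all bits are `true`. The offset 2 lets the induction close: a further
-- digit at most doubles the number plus two.
toBijectiveBinary-< : ∀ p → suc (suc (toℕ (toBijectiveBinary p))) ≤ 2 * 2 ^ length p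
toBijectiveBinary-< []      = ≤-refl
toBijectiveBinary-< (b ∷ p) = begin
  2 + toℕ (toBijectiveBinary (b ∷ p)) ≤⟨ +-monoʳ-≤ 2 (prepend b) ⟩
  2 + 2 * suc n                       ≡⟨ *-suc 2 (suc n) ⟨
  2 * suc (suc n)                     ≤⟨ *-monoʳ-≤ 2 (toBijectiveBinary-< p) ⟩
  2 * 2 ^ length (b ∷ p)              ∎
  where
  open ≤-Reasoning
  n = toℕ (toBijectiveBinary p)
  prepend : ∀ b → toℕ (toBijectiveBinary (b ∷ p)) ≤ 2 * suc n
  prepend false = ≤-trans (n≤1+n _) (≤-reflexive (sym (*-suc 2 n)))
  prepend true  = ≤-refl

words : ℕ → List (List Bool)
words zero    = [] ∷ []
words (suc m) = cartesianProductWith _∷_ (false ∷ true ∷ []) (words m)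

words-unique : ∀ m → Unique (words m)
words-unique zero    = [] ∷ []
words-unique (suc m) =
  Unique.cartesianProductWith⁺ {xs = false ∷ true ∷ []} _∷_ ∷-injective
    (((λ ()) ∷ []) ∷ [] ∷ []) (words-unique m)

words-length : ∀ m → All (λ x → length x ≡ m) (words m)
words-length zero    = refl ∷ []
words-length (suc m) =
  cartesianProductWith⁺ (setoid _) (setoid _) _∷_ (false ∷ true ∷ []) (words m)
    (λ _ x∈ → cong suc (All.lookup (words-length m) x∈))

length-words : ∀ m → length (words m) ≡ 2 ^ m
length-words zero    = refl
length-words (suc m) = trans
  (length-cartesianProductWith _∷_ (false ∷ true ∷ []) (words m)) (cong (2 *_) (length-words m))

module _ (M : Machine) where
  open Machine M

  step-halted : ∀ {l r} → step (l , halt , r) ≡ (l , halt , r)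
  step-halted with halt ≟ᶠ halt
  ... | yes _  = refl
  ... | no h≢h = contradiction refl h≢h

  iterate-halted : ∀ {l r} t → iterate step (l , halt , r) t ≡ (l , halt , r)
  iterate-halted zero    = refl
  iterate-halted (suc t) = trans (cong (λ c → iterate step c t) step-halted) (iterate-halted t)

  -- Both clocks are run down together; when one reaches zero the configuration has halted, and the
  -- remaining steps of the other leave it fixed.
  halted-unique : ∀ c {l r l′ r′} t t′ →
    iterate step c t ≡ (l , halt , r) → iterate step c t′ ≡ (l′ , halt , r′) →
    (l , halt , r) ≡ (l′ , halt , r′)
  halted-unique _ zero    t′       refl eq′  = trans (sym (iterate-halted t′)) eq′
  halted-unique _ (suc t) zero     eq   refl = trans (sym eq) (iterate-halted (suc t))
  halted-unique c (suc t) (suc t′) eq   eq′  = halted-unique (step c) t t′ eq eq′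

  ↦-functional : ∀ {p x x′} → p ↦ x → p ↦ x′ → x ≡ x′
  ↦-functional {p} (t , _ , _ , eq , out) (t′ , _ , _ , eq′ , out′) =
    trans (sym out) (trans (cong (λ (_ , _ , r) → leadingBits r)
      (halted-unique (initial p) t t′ eq eq′)) out′)

  -- A machine is deterministic, so different outputs have different programs and these have
  -- different indices. Hence one index is at least the number of outputs minus one, and the length
  -- of that single program already bounds the count. With `a` = mᵈ and `b` = 2ᵐ the hypothesis says
  -- |p| < m - d log m without logarithms.
  length-outputs : ∀ a b {xs} → Unique xs →
    All (λ x → ∃[ p ] p ↦ x × 2 ^ length p * a < b) xs → length xs * a ≤ 2 * b
  length-outputs a b {[]}     _   _     = z≤n
  length-outputs a b {x ∷ xs} xs! progs = begin
    -- The list `x ∷ xs` has `suc (length xs)` entries, so the pigeonhole lemma applies with n =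
    -- `length xs`.
    suc (length xs) * a           ≤⟨ *-monoˡ-≤ a (s≤s n≤index) ⟩
    suc (index i) * a             ≤⟨ *-monoˡ-≤ a (≤-trans (n≤1+n _) (toBijectiveBinary-< (prog i))) ⟩
    2 * 2 ^ length (prog i) * a   ≡⟨ *-assoc 2 (2 ^ length (prog i)) a ⟩
    2 * (2 ^ length (prog i) * a) ≤⟨ *-monoʳ-≤ 2 (<⇒≤ (proj₂ (proj₂ (All.lookup progs (∈-lookup i))))) ⟩
    2 * b                         ∎
    where
    open ≤-Reasoning
    prog : Fin (length (x ∷ xs)) → List Bool
    prog i = proj₁ (All.lookup progs (∈-lookup i))
    runs : ∀ i → prog i ↦ lookup (x ∷ xs) i
    runs i = proj₁ (proj₂ (All.lookup progs (∈-lookup i)))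
    index : Fin (length (x ∷ xs)) → ℕ
    index = toℕ ∘ toBijectiveBinary ∘ prog
    index-injective : Injective _≡_ _≡_ index
    index-injective {i} {j} eq = lookup-injective xs! (↦-functional
      (subst (_↦ _) (toBijectiveBinary-injective (toℕ-injective eq)) (runs i)) (runs j))
    large = injective-attains-≥ index index-injective
    i = proj₁ large
    n≤index = proj₂ large

-- The start state is the halting state, so the input is the output at time 0. Simulating this
-- machine on `U` gives every string at least one program.
identity : Machine
identity = record { states = 1 ; work = 0 ; start = zero ; halt = zero
                  ; δ = λ q a → q , a , moveR }

identity-↦ : ∀ x → Machine._↦_ identity x x
identity-↦ x = 0 , [] , map bit x , refl , leadingBits-bits x
  where
  leadingBits-bits : ∀ x → Machine.leadingBits identity (map bit x) ≡ x
  leadingBits-bits []      = refl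
  leadingBits-bits (b ∷ x) = cong (b ∷_) (leadingBits-bits x)

module _ (em : ExcludedMiddle 0ℓ) {U : Machine} (universal : Universal U) where
  open Machine U using (_↦_)

  private
    -- Descent on program length: excluded middle tells whether a shorter program for `x` exists,
    -- and if none does, `p` is minimal.
    least : ∀ {x} p → Acc _<_ (length p) → p ↦ x → ∃[ q ] q ↦ x × Kolmogorov U x (length q)
    least {x} p (acc rec) p↦x with em {∃[ q ] q ↦ x × length q < length p}
    ... | yes (q , q↦x , q<p) = least q (rec q<p) q↦x
    ... | no  none = p , p↦x , (p , refl , p↦x) , λ q q↦x → ≮⇒≥ λ q<p → none (q , q↦x , q<p)

  minimal-program : ∀ x → ∃[ p ] p ↦ x × Kolmogorov U x (length p)
  minimal-program x =
    let e , simulates = universal identity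
    in least (e ++ x) (<-wellFounded _) (Equivalence.to (simulates x x) (identity-↦ x))

  ¬Random⇒short-program : ∀ d x → ¬ Random U d x →
    ∃[ p ] p ↦ x × 2 ^ length p * length x ^ d < 2 ^ length x
  ¬Random⇒short-program d x ¬random =
    let p , p↦x , K = minimal-program x
    in p , p↦x , ≰⇒> λ le → ¬random (length p , K , le)

  -- The non-random words are counted instead: each has a short program, so `length-outputs` applies
  -- to them. The last conjunct is the bound (1 - 2 / mᵈ) 2ᵐ on the number of random words, cleared
  -- of its denominator.
  random-words : ∀ d m → ∃[ xs ] Unique xs
    × All (λ x → length x ≡ m × Random U d x) xs
    × 2 ^ m * m ^ d ≤ length xs * m ^ d + 2 * 2 ^ m
  random-words d m = xs , Unique.filter⁺ random? (words-unique m) , All.tabulate member , count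
    where
    random? : Decidable (Random U d)
    random? x = em
    xs = filter random? (words m)
    ys = filter (¬? ∘ random?) (words m)

    member : ∀ {x} → x ∈ xs → length x ≡ m × Random U d x
    member x∈ = let x∈words , random = ∈-filter⁻ random? x∈
                in All.lookup (words-length m) x∈words , random

    short : ∀ {y} → y ∈ ys → ∃[ p ] p ↦ y × 2 ^ length p * m ^ d < 2 ^ m
    short {y} y∈ with ∈-filter⁻ (¬? ∘ random?) {xs = words m} y∈
    ... | y∈words , ¬random with All.lookup (words-length m) y∈words
    -- Matching identifies `m` with `length y`, in terms of which the short-program bound is
    -- phrased.
    ... | refl = ¬Random⇒short-program d y ¬random

    open ≤-Reasoning
    count : 2 ^ m * m ^ d ≤ length xs * m ^ d + 2 * 2 ^ m
    count = begin
      2 ^ m * m ^ d                         ≡⟨ cong (_* m ^ d) (length-words m) ⟨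
      length (words m) * m ^ d              ≡⟨ cong (_* m ^ d) (length-filter-complement random? (words m)) ⟩
      (length xs + length ys) * m ^ d       ≡⟨ *-distribʳ-+ (m ^ d) (length xs) (length ys) ⟩
      length xs * m ^ d + length ys * m ^ d ≤⟨ +-monoʳ-≤ (length xs * m ^ d)
          (length-outputs U (m ^ d) (2 ^ m)
            (Unique.filter⁺ (¬? ∘ random?) (words-unique m)) (All.tabulate short)) ⟩
      length xs * m ^ d + 2 * 2 ^ m         ∎

theorem3p3 : ExcludedMiddle 0ℓ →
    (U : Machine) → Universal U →
    (d : ℕ) → 3 ≤ d →
    {L : Language} (S : FiniteTheory L) →
    Sound S → Sequential S → ExtendsS¹₂ S → PolyTimeAxioms S →
    PolySizeProofs S (Con≤ S) →
    (kR : ℕ) → (∀ x → C-rel S U d x → length x < kR) →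
    SETH-K-Finite S U d kR →
    ∃[ C ] ∀ m → kR < m → ∀ ε → lower ε 0ℚ → upper ε 1ℚ →
    ∃[ N ] ∀ n → N < n →
    ∃[ xs ] Unique xs
    × All (λ (x : List Bool) → length x ≡ m × Random U d x × ¬ ShortProof S U d ε n x) xs
    × 2 ^ m * m ^ d ≤ length xs * m ^ d + C * 2 ^ m
theorem3p3 em U universal d _ S _ _ _ _ _ kR C-rel< seth =
  -- The constant 2 comes from `random-words` and serves all m and ε. The threshold `N` is that of
  -- SETH-K-Finite, uniform in x, and the same list `xs` works for every n beyond it.
  2 , λ m kR<m ε 0<ε ε<1 →
    let N , short⇔relative        = seth m kR<m ε 0<ε ε<1
        xs , xs! , random , count = random-words em universal d m
    in N , λ n N<n → xs , xs! ,
      All.map (λ {x} (∣x∣≡m , r) → ∣x∣≡m , r , λ short →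
        <-asym kR<m (subst (_< kR) ∣x∣≡m
          (C-rel< x (r , Equivalence.to (short⇔relative x ∣x∣≡m r n N<n) short))))
        random ,
      count
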